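{- A maximal $2$-cap in $\mathbb{F}_3^5$ has size $13$, i.e. $r(2,\mathbb{F}_3^5)=13$.
   Context: $\mathbb{F}_3^n$ denotes $n$-dimensional affine space over the field with three elements. A subset $C \subseteq \mathbb{F}_3^n$ is a $2$-cap if no three points of $C$ lie on a $1$-dimensional affine subspace and no four points of $C$ lie on a $2$-dimensional affine subspace (equivalently, every subset of $C$ of size at most $4$ is affinely independent). $r(2,\mathbb{F}_3^n)$ denotes the largest cardinality of a $2$-cap in $\mathbb{F}_3^n$; a maximal $2$-cap is one of this cardinality. -}

module Defs where

open import Data.Nat using (ℕ; zero; suc; _≤_)
open import Data.Fin using (Fin; zero; suc)
open import Data.Vec using (Vec; lookup)
open import Data.List using (List; length)
open import Data.List.Membership.Propositional using (_∈_)
open import Data.List.Relation.Unary.Unique.Propositional using (Unique)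
open import Data.Product using (_×_; Σ-syntax)
open import Function.Definitions using (Injective)
open import Relation.Binary.PropositionalEquality using (_≡_)

F₃ : Set
F₃ = Fin 3

pattern 0₃ = zero
pattern 1₃ = suc zero
pattern 2₃ = suc (suc zero)

infixl 6 _+₃_
infixl 7 _*₃_

_+₃_ : F₃ → F₃ → F₃
0₃ +₃ y  = y
1₃ +₃ 0₃ = 1₃
1₃ +₃ 1₃ = 2₃
1₃ +₃ 2₃ = 0₃
2₃ +₃ 0₃ = 2₃
2₃ +₃ 1₃ = 0₃
2₃ +₃ 2₃ = 1₃

_*₃_ : F₃ → F₃ → F₃
0₃ *₃ y  = 0₃
1₃ *₃ y  = y
2₃ *₃ 0₃ = 0₃
2₃ *₃ 1₃ = 2₃
2₃ *₃ 2₃ = 1₃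

Point : ℕ → Set
Point n = Vec F₃ n

∑ : (k : ℕ) → (Fin k → F₃) → F₃
∑ zero    f = 0₃
∑ (suc k) f = f zero +₃ ∑ k (λ i → f (suc i))

AffinelyIndependent : {n k : ℕ} → (Fin k → Point n) → Set
AffinelyIndependent {n} {k} p =
  (c : Fin k → F₃) →
  ∑ k c ≡ 0₃ →
  ((j : Fin n) → ∑ k (λ i → c i *₃ lookup (p i) j) ≡ 0₃) →
  (i : Fin k) → c i ≡ 0₃

Is2Cap : (n : ℕ) → List (Point n) → Set
Is2Cap n C =
  Unique C ×
  ((k : ℕ) → k ≤ 4 → (p : Fin k → Point n) → Injective _≡_ _≡_ p →
     ((i : Fin k) → p i ∈ C) → AffinelyIndependent p)

MaxCapSize : (n m : ℕ) → Set
MaxCapSize n m =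
  (Σ[ C ∈ List (Point n) ] (Is2Cap n C × length C ≡ m)) ×
  ((C : List (Point n)) → Is2Cap n C → length C ≤ m)

{-# OPTIONS --safe #-}
module Submission where

-- A 2-cap in F₃ⁿ is the same as a Sidon set: a + b = c + d only for {a, b} = {c, d}.
--
-- Suppose a Sidon set in F₃⁵ has 14 points, one of them 0. The 182 nonzero differences and the 78 sums
-- of two distinct nonzero points cannot all be distinct among 243 vectors; a collision gives x = a + b + c with
-- a, b, c, x in the set and a, b, c independent. The span F of a, b, c contains no further point, since
-- every vector of F is a difference of the form y + z − w with w, y, z ∈ {0, a, b, c, x}. The other nine
-- points lie in the eight nontrivial cosets of F, so two of them differ by some w ∈ F. In a suitable
-- basis the set contains 0, a, b, c, a + b + c, e, e + w, e′, and for each of the 26 values of w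
-- an exhaustive search shows that no six points can be added.

open import Data.Bool using (Bool; true; false; not; _∧_; _∨_; T)
open import Data.Bool.ListAction using (all; any)
open import Data.Bool.Properties using (T-∧; T-∨; T-≡; T?)
open import Data.Empty using (⊥; ⊥-elim)
open import Data.Fin as Fin using (Fin; zero; suc; _≟_; inject≤)
open import Data.Fin.Patterns
open import Data.Fin.Properties as Fin using (inject≤-injective; injective⇒≤)
open import Data.List as List
  using (List; []; _∷_; _++_; length; map; filter; foldr; allFin; cartesianProduct; cartesianProductWith)
open import Data.List.Properties using (length-map; length-++; filter-all)
open import Data.List.Membership.Propositional using (_∈_; _∉_)
open import Data.List.Membership.Propositional.Properties
open import Data.List.Relation.Binary.Sublist.Propositional using (_⊆_; []; _∷ʳ_; _∷_)
open import Data.List.Relation.Binary.Sublist.Propositional.Properties using (filter⁺; filter-⊆)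
open import Data.List.Relation.Binary.Sublist.Heterogeneous.Properties using (length-mono-≤)
open import Data.List.Relation.Unary.All as All using (All; []; _∷_)
import Data.List.Relation.Unary.All.Properties as All
open import Data.List.Relation.Unary.AllPairs using ([]; _∷_)
open import Data.List.Relation.Unary.Any using (here; there; index)
open import Data.List.Relation.Unary.Any.Properties using (lookup-index)
open import Data.List.Relation.Unary.Unique.Propositional using (Unique)
import Data.List.Relation.Unary.Unique.Propositional.Properties as Unique
open import Data.Nat using (ℕ; zero; suc; _+_; _*_; _≤_; _<_; s≤s; z<s; s<s)
import Data.Nat.Properties as ℕ
open import Data.Product as Product using (∃; ∃-syntax; ∃₂; _×_; _,_; proj₁; proj₂)
open import Data.Sum as Sum using (_⊎_; inj₁; inj₂; [_,_]′)
open import Data.Unit using (tt)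
open import Data.Vec as Vec using (Vec; []; _∷_; lookup; zipWith; replicate; tabulate)
open import Data.Vec.Properties as Vec
  using (lookup-zipWith; lookup-replicate; lookup-map; lookup∘tabulate; tabulate∘lookup; tabulate-cong; ∷-injective)
import Data.Vec.Relation.Unary.All as VecAll
import Data.Vec.Relation.Unary.AllPairs as VecAllPairs
open import Data.Vec.Relation.Unary.Unique.Propositional using () renaming (Unique to VecUnique)
open import Data.Vec.Relation.Unary.Unique.Propositional.Properties using (lookup-injective)
open import Function using (_∘_; id; Injective; Equivalence)
open import Relation.Binary.PropositionalEquality
open import Relation.Nullary
open import Relation.Nullary.Decidable using (⌊_⌋; toWitness; True)

open import Defs

-- Decidable quantification over the points of F₃ⁿ

∀? : ∀ {n} {P : Point n → Set} → (∀ v → Dec (P v)) → Dec (∀ v → P v)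
∀? {zero}  P? = map′ (λ { p [] → p }) (λ f → f []) (P? [])
∀? {suc n} P? = map′ (λ { f (a ∷ v) → f a v }) (λ f a v → f (a ∷ v))
                     (Fin.all? λ a → ∀? λ v → P? (a ∷ v))

∃? : ∀ {n} {P : Point n → Set} → (∀ v → Dec (P v)) → Dec (∃ P)
∃? {zero}  P? = map′ ([] ,_) (λ { ([] , p) → p }) (P? [])
∃? {suc n} P? = map′ (λ { (a , v , p) → a ∷ v , p }) (λ { (a ∷ v , p) → a , v , p })
                     (Fin.any? λ a → ∃? λ v → P? (a ∷ v))

infix 4 _≟ᵖ_

_≟ᵖ_ : ∀ {n} (u v : Point n) → Dec (u ≡ v)
_≟ᵖ_ = Vec.≡-dec _≟_

-- Vectors over F₃

_-₃_ : F₃ → F₃ → F₃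
x -₃ 0₃ = x
x -₃ 1₃ = x +₃ 2₃
x -₃ 2₃ = x +₃ 1₃

infixl 6 _⊕_ _⊖_
infixr 7 _·_

_⊕_ _⊖_ : ∀ {n} → Point n → Point n → Point n
_⊕_ = zipWith _+₃_
_⊖_ = zipWith _-₃_

𝟎 : ∀ {n} → Point n
𝟎 = replicate _ 0₃

_·_ : ∀ {n} → F₃ → Point n → Point n
c · v = Vec.map (c *₃_) v

infixl 6 _⊞_ _⊟_
infixr 7 _⊡_

-- The same syntax is evaluated in F₃ⁿ and, coordinate by coordinate, in F₃, where a claim about m
-- variables is a finite check independent of n.
data Expr (m : ℕ) : Set where
  var     : Fin m → Expr m
  𝟘       : Expr m
  _⊞_ _⊟_ : Expr m → Expr m → Expr m
  _⊡_     : F₃ → Expr m → Expr m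

pattern x₀ = var 0F
pattern x₁ = var 1F
pattern x₂ = var 2F
pattern x₃ = var 3F
pattern x₄ = var 4F

⟦_⟧ : ∀ {m n} → Expr m → Vec (Point n) m → Point n
⟦ var i ⟧ ρ = lookup ρ i
⟦ 𝟘 ⟧     ρ = 𝟎
⟦ e ⊞ f ⟧ ρ = ⟦ e ⟧ ρ ⊕ ⟦ f ⟧ ρ
⟦ e ⊟ f ⟧ ρ = ⟦ e ⟧ ρ ⊖ ⟦ f ⟧ ρ
⟦ c ⊡ e ⟧ ρ = c · ⟦ e ⟧ ρ

⟦_⟧₃ : ∀ {m} → Expr m → Point m → F₃
⟦ var i ⟧₃ ρ = lookup ρ i
⟦ 𝟘 ⟧₃     ρ = 0₃
⟦ e ⊞ f ⟧₃ ρ = ⟦ e ⟧₃ ρ +₃ ⟦ f ⟧₃ ρ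
⟦ e ⊟ f ⟧₃ ρ = ⟦ e ⟧₃ ρ -₃ ⟦ f ⟧₃ ρ
⟦ c ⊡ e ⟧₃ ρ = c *₃ ⟦ e ⟧₃ ρ

column : ∀ {m n} → Vec (Point n) m → Fin n → Point m
column ρ j = Vec.map (λ v → lookup v j) ρ

lookup-⟦⟧ : ∀ {m n} (e : Expr m) (ρ : Vec (Point n) m) j →
            lookup (⟦ e ⟧ ρ) j ≡ ⟦ e ⟧₃ (column ρ j)
lookup-⟦⟧ (var i) ρ j = sym (lookup-map i _ ρ)
lookup-⟦⟧ 𝟘       ρ j = lookup-replicate j 0₃
lookup-⟦⟧ (e ⊞ f) ρ j = trans (lookup-zipWith _+₃_ j (⟦ e ⟧ ρ) (⟦ f ⟧ ρ))
                              (cong₂ _+₃_ (lookup-⟦⟧ e ρ j) (lookup-⟦⟧ f ρ j))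
lookup-⟦⟧ (e ⊟ f) ρ j = trans (lookup-zipWith _-₃_ j (⟦ e ⟧ ρ) (⟦ f ⟧ ρ))
                              (cong₂ _-₃_ (lookup-⟦⟧ e ρ j) (lookup-⟦⟧ f ρ j))
lookup-⟦⟧ (c ⊡ e) ρ j = trans (lookup-map j (c *₃_) (⟦ e ⟧ ρ)) (cong (c *₃_) (lookup-⟦⟧ e ρ j))

lookup-ext : ∀ {n} {u v : Point n} → (∀ j → lookup u j ≡ lookup v j) → u ≡ v
lookup-ext {u = u} {v} eq =
  trans (sym (tabulate∘lookup u)) (trans (tabulate-cong eq) (tabulate∘lookup v))

-- An implication between linear equations is checked coordinatewise, by a truth table over F₃.
entails : ∀ {m} (l r l′ r′ : Expr m) →
          {True (∀? λ ρ → (⟦ l ⟧₃ ρ ≟ ⟦ r ⟧₃ ρ) →-dec (⟦ l′ ⟧₃ ρ ≟ ⟦ r′ ⟧₃ ρ))} →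
          ∀ {n} (ρ : Vec (Point n) m) → ⟦ l ⟧ ρ ≡ ⟦ r ⟧ ρ → ⟦ l′ ⟧ ρ ≡ ⟦ r′ ⟧ ρ
entails l r l′ r′ {ok} ρ eq = lookup-ext λ j →
  trans (lookup-⟦⟧ l′ ρ j)
    (trans (toWitness ok (column ρ j)
             (trans (sym (lookup-⟦⟧ l ρ j)) (trans (cong (λ v → lookup v j) eq) (lookup-⟦⟧ r ρ j))))
           (sym (lookup-⟦⟧ r′ ρ j)))

-- The vacuous premise `0₃ ≟ 0₃` makes the check the one that `entails` asks for when its hypothesis
-- is 𝟘 = 𝟘.
identity : ∀ {m} (l r : Expr m) → {True (∀? λ ρ → (0₃ ≟ 0₃) →-dec (⟦ l ⟧₃ ρ ≟ ⟦ r ⟧₃ ρ))} →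
           ∀ {n} (ρ : Vec (Point n) m) → ⟦ l ⟧ ρ ≡ ⟦ r ⟧ ρ
identity l r {ok} ρ = entails 𝟘 𝟘 l r {ok} ρ refl

⊕-comm : ∀ {n} (u v : Point n) → u ⊕ v ≡ v ⊕ u
⊕-comm u v = identity (x₀ ⊞ x₁) (x₁ ⊞ x₀) (u ∷ v ∷ [])

⊕-cancelˡ : ∀ {n} (u v w : Point n) → u ⊕ v ≡ u ⊕ w → v ≡ w
⊕-cancelˡ u v w = entails (x₀ ⊞ x₁) (x₀ ⊞ x₂) x₁ x₂ (u ∷ v ∷ w ∷ [])

⊖-cross : ∀ {n} (u v w x : Point n) → u ⊖ v ≡ w ⊖ x → u ⊕ x ≡ w ⊕ v
⊖-cross u v w x = entails (x₀ ⊟ x₁) (x₂ ⊟ x₃) (x₀ ⊞ x₃) (x₂ ⊞ x₁) (u ∷ v ∷ w ∷ x ∷ [])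

·-distribʳ : ∀ {n} c d (v : Point n) → (c +₃ d) · v ≡ c · v ⊕ d · v
·-distribʳ c d []      = refl
·-distribʳ c d (x ∷ v) = cong₂ _∷_ (table c d x) (·-distribʳ c d v)
  where
  table : ∀ c d x → (c +₃ d) *₃ x ≡ c *₃ x +₃ d *₃ x
  table = toWitness {a? = Fin.all? λ c → Fin.all? λ d → Fin.all? λ x → _ ≟ _} tt

-- Linear combinations and independent families

lin : ∀ {k n} → Point k → Vec (Point n) k → Point n
lin []      []       = 𝟎
lin (c ∷ u) (v ∷ vs) = c · v ⊕ lin u vs

lin-⊕ : ∀ {k n} (u w : Point k) (vs : Vec (Point n) k) → lin (u ⊕ w) vs ≡ lin u vs ⊕ lin w vs
lin-⊕ []      []      []       = identity 𝟘 (𝟘 ⊞ 𝟘) []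
lin-⊕ (c ∷ u) (d ∷ w) (v ∷ vs) = trans
  (cong₂ _⊕_ (·-distribʳ c d v) (lin-⊕ u w vs))
  (identity ((x₀ ⊞ x₁) ⊞ (x₂ ⊞ x₃)) ((x₀ ⊞ x₂) ⊞ (x₁ ⊞ x₃)) (c · v ∷ d · v ∷ lin u vs ∷ lin w vs ∷ []))

-- Over F₃, subtracting w is adding w twice, which reduces the claim to `lin-⊕`.
lin-⊖ : ∀ {k n} (u w : Point k) (vs : Vec (Point n) k) → lin (u ⊖ w) vs ≡ lin u vs ⊖ lin w vs
lin-⊖ u w vs = trans
  (cong (λ z → lin z vs) (identity (x₀ ⊟ x₁) (x₀ ⊞ (x₁ ⊞ x₁)) (u ∷ w ∷ [])))
  (trans (lin-⊕ u (w ⊕ w) vs) (trans (cong (lin u vs ⊕_) (lin-⊕ w w vs))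
    (identity (x₀ ⊞ (x₁ ⊞ x₁)) (x₀ ⊟ x₁) (lin u vs ∷ lin w vs ∷ []))))

lin-𝟎 : ∀ {k n} (vs : Vec (Point n) k) → lin 𝟎 vs ≡ 𝟎
lin-𝟎 []       = refl
lin-𝟎 (v ∷ vs) = trans (cong (0₃ · v ⊕_) (lin-𝟎 vs)) (identity (0₃ ⊡ x₀ ⊞ 𝟘) 𝟘 (v ∷ []))

Independent : ∀ {k n} → Vec (Point n) k → Set
Independent vs = ∀ u → lin u vs ≡ 𝟎 → u ≡ 𝟎

Spans : ∀ {k n} → Vec (Point n) k → Point n → Set
Spans vs z = ∃[ u ] lin u vs ≡ z

spans? : ∀ {k n} (vs : Vec (Point n) k) z → Dec (Spans vs z)
spans? vs z = ∃? λ u → lin u vs ≟ᵖ z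

lin-injective : ∀ {k n} {vs : Vec (Point n) k} → Independent vs →
                ∀ {u w} → lin u vs ≡ lin w vs → u ≡ w
lin-injective {vs = vs} ind {u} {w} eq =
  entails (x₀ ⊟ x₁) 𝟘 x₀ x₁ (u ∷ w ∷ []) (ind (u ⊖ w)
    (trans (lin-⊖ u w vs)
      (entails x₀ x₁ (x₀ ⊟ x₁) 𝟘 (lin u vs ∷ lin w vs ∷ []) eq)))

-- In a vanishing combination, coefficient 1 of z gives z = `lin (u ⊕ u) vs` and coefficient 2 gives
-- z = `lin u vs`; both put z in the span.
independent-∷ : ∀ {k n} {vs : Vec (Point n) k} {z} →
                Independent vs → ¬ Spans vs z → Independent (z ∷ vs)
independent-∷ {vs = vs} {z} ind z∉ (0₃ ∷ u) eq =
  cong (0₃ ∷_) (ind u (trans (identity x₁ (0₃ ⊡ x₀ ⊞ x₁) (z ∷ lin u vs ∷ [])) eq))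
independent-∷ {vs = vs} {z} ind z∉ (1₃ ∷ u) eq =
  ⊥-elim (z∉ (u ⊕ u , trans (lin-⊕ u u vs)
    (entails (1₃ ⊡ x₀ ⊞ x₁) 𝟘 (x₁ ⊞ x₁) x₀ (z ∷ lin u vs ∷ []) eq)))
independent-∷ {vs = vs} {z} ind z∉ (2₃ ∷ u) eq =
  ⊥-elim (z∉ (u , entails (2₃ ⊡ x₀ ⊞ x₁) 𝟘 x₁ x₀ (z ∷ lin u vs ∷ []) eq))

-- Counting with lists

module _ {A : Set} where

  Unique-lookup-injective : ∀ {xs : List A} → Unique xs → ∀ i j →
                            List.lookup xs i ≡ List.lookup xs j → i ≡ j
  Unique-lookup-injective (_ ∷ _)   zero    zero    _  = refl
  Unique-lookup-injective (x∉ ∷ _)  zero    (suc j) eq = ⊥-elim (All.lookup x∉ (∈-lookup j) eq)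
  Unique-lookup-injective (x∉ ∷ _)  (suc i) zero    eq = ⊥-elim (All.lookup x∉ (∈-lookup i) (sym eq))
  Unique-lookup-injective (_ ∷ xs!) (suc i) (suc j) eq = cong suc (Unique-lookup-injective xs! i j eq)

  -- Pigeonhole principle: sending a position in `xs` to a position of the same element in `ys` is
  -- injective.
  Unique⇒length≤ : ∀ {xs ys : List A} → Unique xs → (∀ {x} → x ∈ xs → x ∈ ys) → length xs ≤ length ys
  Unique⇒length≤ {xs} {ys} xs! sub = injective⇒≤ {f = λ i → index (sub (∈-lookup {xs = xs} i))} λ {i} {j} eq →
    Unique-lookup-injective xs! i j
      (trans (lookup-index (sub (∈-lookup i)))
        (trans (cong (List.lookup ys) eq) (sym (lookup-index (sub (∈-lookup j))))))

  Unique-map⁺ : ∀ {B : Set} {f : A → B} {xs} →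
                (∀ {x y} → x ∈ xs → y ∈ xs → f x ≡ f y → x ≡ y) → Unique xs → Unique (map f xs)
  Unique-map⁺ inj []         = []
  Unique-map⁺ inj (x∉ ∷ xs!) =
    All.tabulate (λ z∈ eq → let y , y∈ , z≡ = ∈-map⁻ _ z∈ in
                   All.lookup x∉ y∈ (inj (here refl) (there y∈) (trans eq z≡)))
    ∷ Unique-map⁺ (λ x∈ y∈ → inj (there x∈) (there y∈)) xs!

-- `length (points n)` stands for 3ⁿ; for a numeral n it evaluates, so numerical comparisons are
-- decided by computation.
points : ∀ n → List (Point n)
points zero    = [] ∷ []
points (suc n) = cartesianProductWith _∷_ (allFin 3) (points n)

∈-points : ∀ {n} (u : Point n) → u ∈ points n
∈-points []      = here refl
∈-points (c ∷ u) = ∈-cartesianProductWith⁺ _∷_ (∈-allFin c) (∈-points u)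

points-unique : ∀ n → Unique (points n)
points-unique zero    = [] ∷ []
points-unique (suc n) = Unique.cartesianProductWith⁺ _∷_ ∷-injective (Unique.allFin⁺ 3) (points-unique n)

independent⇒length≤ : ∀ {k n} {vs : Vec (Point n) k} → Independent vs → length (points k) ≤ length (points n)
independent⇒length≤ {k} {vs = vs} ind =
  subst (_≤ _) (length-map (λ u → lin u vs) (points k))
    (Unique⇒length≤ (Unique.map⁺ (lin-injective ind) (points-unique k)) (λ {z} _ → ∈-points z))

spans-length≤ : ∀ {k n} {vs : Vec (Point n) k} {zs} → Unique zs → (∀ {z} → z ∈ zs → Spans vs z) →
                length zs ≤ length (points k)
spans-length≤ {k} {vs = vs} {zs} zs! sp =
  subst (length zs ≤_) (length-map (λ u → lin u vs) (points k))
    (Unique⇒length≤ zs! λ z∈ → let u , eq = sp z∈ in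
      subst (_∈ map (λ u → lin u vs) (points k)) eq (∈-map⁺ _ (∈-points u)))

-- Otherwise n + 1 independent vectors would have 3ⁿ⁺¹ distinct combinations in F₃ⁿ.
independent⇒spans : ∀ {n} {vs : Vec (Point n) n} → Independent vs →
                    length (points n) < length (points (suc n)) → ∀ z → Spans vs z
independent⇒spans {vs = vs} ind lt z with spans? vs z
... | yes p = p
... | no ¬p = ⊥-elim (ℕ.<⇒≱ lt (independent⇒length≤ (independent-∷ ind ¬p)))

-- Exhaustive search for Sidon sets

-- A set of points as a ternary tree branching on successive coordinates: a lookup takes at most n
-- steps, however large the set.
data Trie : ℕ → Set where
  empty : ∀ {n} → Trie n
  leaf  : Trie 0
  node  : ∀ {n} → Trie n → Trie n → Trie n → Trie (suc n)

insert : ∀ {n} → Point n → Trie n → Trie n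
insert []       _            = leaf
insert (0₃ ∷ u) empty        = node (insert u empty) empty empty
insert (1₃ ∷ u) empty        = node empty (insert u empty) empty
insert (2₃ ∷ u) empty        = node empty empty (insert u empty)
insert (0₃ ∷ u) (node a b c) = node (insert u a) b c
insert (1₃ ∷ u) (node a b c) = node a (insert u b) c
insert (2₃ ∷ u) (node a b c) = node a b (insert u c)

member : ∀ {n} → Trie n → Point n → Bool
member empty        _        = false
member leaf         []       = true
member (node a b c) (0₃ ∷ u) = member a u
member (node a b c) (1₃ ∷ u) = member b u
member (node a b c) (2₃ ∷ u) = member c u

member-insert⁻ : ∀ {n} (u v : Point n) t → T (member (insert u t) v) → v ≡ u ⊎ T (member t v)
member-insert⁻ []       []       t            m = inj₁ refl
member-insert⁻ (0₃ ∷ u) (0₃ ∷ v) empty        m = Sum.map₁ (cong (0₃ ∷_)) (member-insert⁻ u v empty m)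
member-insert⁻ (0₃ ∷ u) (0₃ ∷ v) (node a b c) m = Sum.map₁ (cong (0₃ ∷_)) (member-insert⁻ u v a m)
member-insert⁻ (0₃ ∷ u) (1₃ ∷ v) (node a b c) m = inj₂ m
member-insert⁻ (0₃ ∷ u) (2₃ ∷ v) (node a b c) m = inj₂ m
member-insert⁻ (1₃ ∷ u) (0₃ ∷ v) (node a b c) m = inj₂ m
member-insert⁻ (1₃ ∷ u) (1₃ ∷ v) empty        m = Sum.map₁ (cong (1₃ ∷_)) (member-insert⁻ u v empty m)
member-insert⁻ (1₃ ∷ u) (1₃ ∷ v) (node a b c) m = Sum.map₁ (cong (1₃ ∷_)) (member-insert⁻ u v b m)
member-insert⁻ (1₃ ∷ u) (2₃ ∷ v) (node a b c) m = inj₂ m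
member-insert⁻ (2₃ ∷ u) (0₃ ∷ v) (node a b c) m = inj₂ m
member-insert⁻ (2₃ ∷ u) (1₃ ∷ v) (node a b c) m = inj₂ m
member-insert⁻ (2₃ ∷ u) (2₃ ∷ v) empty        m = Sum.map₁ (cong (2₃ ∷_)) (member-insert⁻ u v empty m)
member-insert⁻ (2₃ ∷ u) (2₃ ∷ v) (node a b c) m = Sum.map₁ (cong (2₃ ∷_)) (member-insert⁻ u v c m)

fewer : ∀ {A : Set} → List A → ℕ → Bool
fewer _        zero    = false
fewer []       (suc k) = true
fewer (_ ∷ xs) (suc k) = fewer xs k

fewer-sound : ∀ {A : Set} (xs : List A) k → T (fewer xs k) → length xs < k
fewer-sound []       (suc k) _ = z<s
fewer-sound (_ ∷ xs) (suc k) t = s<s (fewer-sound xs k t)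

-- `S` and `D` are the tables from before `c` was chosen. A hit means c + y = a + b or c + b = a + y
-- with a, b chosen earlier.
compatible : ∀ {n} → Trie n → Trie n → Point n → Point n → Bool
compatible S D c y = not (member S (c ⊕ y)) ∧ not (member D (c ⊖ y))

addSums : ∀ {n} → List (Point n) → Point n → Trie n → Trie n
-- Folding over `c ∷ B` also records c + c, so two later candidates collinear with `c` become
-- incompatible.
addSums B c S = foldr (λ a → insert (c ⊕ a)) S (c ∷ B)

addDiffs : ∀ {n} → List (Point n) → Point n → Trie n → Trie n
addDiffs B c D = foldr (λ a t → insert (c ⊖ a) (insert (a ⊖ c) t)) D B

-- The points chosen so far are listed in B, and S and D hold their sums and differences.
-- A chosen point is only combined with later candidates.
noExtension : ∀ {n} → ℕ → List (Point n) → Trie n → Trie n → List (Point n) → Bool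
noExtension zero    B S D cs       = false
noExtension (suc k) B S D []       = true
noExtension (suc k) B S D (c ∷ cs) = fewer cs k ∨
  (noExtension k (c ∷ B) (addSums B c S) (addDiffs B c D) (filter (T? ∘ compatible S D c) cs)
    ∧ noExtension (suc k) B S D cs)

-- The points of `bs` are forced. If `c ⊕ a` is already a tabulated sum, the base itself is not
-- Sidon and nothing extends it.
noExtensionFrom : ∀ {n} → ℕ → List (Point n) → List (Point n) → Trie n → Trie n → List (Point n) → Bool
noExtensionFrom k []       B S D cs = noExtension k B S D cs
noExtensionFrom k (c ∷ bs) B S D cs = any (λ a → member S (c ⊕ a)) B ∨
  noExtensionFrom k bs (c ∷ B) (addSums B c S) (addDiffs B c D) (filter (T? ∘ compatible S D c) cs)

-- Soundness of the search

Sidon : ∀ {n} → (Point n → Set) → Set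
Sidon M = ∀ {a b c d} → M a → M b → M c → M d → a ⊕ b ≡ c ⊕ d → (a ≡ c × b ≡ d) ⊎ (a ≡ d × b ≡ c)

-- Every entry comes from points of `B`, so a candidate is discarded only for a genuine conflict.
record Tabulates {n} (B : List (Point n)) (S D : Trie n) : Set where
  field
    sums  : ∀ v → T (member S v) → ∃₂ λ a b → a ∈ B × b ∈ B × v ≡ a ⊕ b
    diffs : ∀ v → T (member D v) → ∃₂ λ a b → a ∈ B × b ∈ B × v ≡ a ⊖ b

open Tabulates

addSums-sound : ∀ {n} {S : Trie n} A c v → T (member (foldr (λ a → insert (c ⊕ a)) S A) v) →
                (∃[ a ] a ∈ A × v ≡ c ⊕ a) ⊎ T (member S v)
addSums-sound []      c v m = inj₂ m
addSums-sound (a ∷ A) c v m with member-insert⁻ (c ⊕ a) v _ m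
... | inj₁ eq = inj₁ (a , here refl , eq)
... | inj₂ m′ = Sum.map₁ (λ (a′ , a′∈ , eq) → a′ , there a′∈ , eq) (addSums-sound A c v m′)

addDiffs-sound : ∀ {n} {D : Trie n} A c v → T (member (addDiffs A c D) v) →
                 (∃[ a ] a ∈ A × (v ≡ c ⊖ a ⊎ v ≡ a ⊖ c)) ⊎ T (member D v)
addDiffs-sound []      c v m = inj₂ m
addDiffs-sound (a ∷ A) c v m with member-insert⁻ (c ⊖ a) v _ m
... | inj₁ eq = inj₁ (a , here refl , inj₁ eq)
... | inj₂ m′ with member-insert⁻ (a ⊖ c) v _ m′
...   | inj₁ eq = inj₁ (a , here refl , inj₂ eq)
...   | inj₂ m″ = Sum.map₁ (λ (a′ , a′∈ , eq) → a′ , there a′∈ , eq) (addDiffs-sound A c v m″)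

tabulates-[] : ∀ {n} → Tabulates {n} [] empty empty
tabulates-[] = record { sums = λ _ () ; diffs = λ _ () }

tabulates-∷ : ∀ {n} {B : List (Point n)} {S D} c → Tabulates B S D →
              Tabulates (c ∷ B) (addSums B c S) (addDiffs B c D)
tabulates-∷ {B = B} c tab .sums v m with addSums-sound (c ∷ B) c v m
... | inj₁ (a , a∈ , eq) = c , a , here refl , a∈ , eq
... | inj₂ m′ = let a , b , a∈ , b∈ , eq = sums tab v m′ in a , b , there a∈ , there b∈ , eq
tabulates-∷ {B = B} c tab .diffs v m with addDiffs-sound B c v m
... | inj₁ (a , a∈ , inj₁ eq) = c , a , here refl , there a∈ , eq
... | inj₁ (a , a∈ , inj₂ eq) = a , c , there a∈ , here refl , eq
... | inj₂ m′ = let a , b , a∈ , b∈ , eq = diffs tab v m′ in a , b , there a∈ , there b∈ , eq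

T-not⁺ : ∀ {b} → ¬ T b → T (not b)
T-not⁺ {false} _  = tt
T-not⁺ {true}  ¬t = ¬t tt

module _ {n} {M : Point n → Set} (sidon : Sidon M) where

  -- A hit in either table is an equality of two sums, by which the Sidon property identifies `c`
  -- with a chosen point or with `y`.
  compatible-complete : ∀ {B S D c y} → Tabulates B S D → All M B → M c → M y →
                        c ≢ y → c ∉ B → T (compatible S D c y)
  compatible-complete {c = c} {y} tab MB Mc My c≢y c∉ = Equivalence.from T-∧ (T-not⁺ noSum , T-not⁺ noDiff)
    where
    noSum : ¬ T _
    noSum m with a , b , a∈ , b∈ , eq ← sums tab _ m
      with sidon Mc My (All.lookup MB a∈) (All.lookup MB b∈) eq
    ... | inj₁ (refl , _) = c∉ a∈
    ... | inj₂ (refl , _) = c∉ b∈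
    noDiff : ¬ T _
    noDiff m with a , b , a∈ , b∈ , eq ← diffs tab _ m
      with sidon Mc (All.lookup MB b∈) (All.lookup MB a∈) My (⊖-cross c y a b eq)
    ... | inj₁ (refl , _) = c∉ a∈
    ... | inj₂ (c≡y , _)  = c≢y c≡y

  base-conflict-free : ∀ {B S D c} A → Tabulates B S D → All M B → All M A → M c → c ∉ B →
                       ¬ T (any (λ a → member S (c ⊕ a)) A)
  base-conflict-free (a ∷ A) tab MB (Ma ∷ MA) Mc c∉ t with Equivalence.to T-∨ t
  ... | inj₂ t′ = base-conflict-free A tab MB MA Mc c∉ t′
  ... | inj₁ m with b , d , b∈ , d∈ , eq ← sums tab _ m
    with sidon Mc Ma (All.lookup MB b∈) (All.lookup MB d∈) eq
  ...   | inj₁ (refl , _) = c∉ b∈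
  ...   | inj₂ (refl , _) = c∉ d∈

  ∉-∷ : ∀ {c : Point n} {B L} → All (c ≢_) L → All (_∉ B) L → All (_∉ (c ∷ B)) L
  ∉-∷ c≢ L∉ = All.zipWith (λ { (c≢y , y∉) (here y≡c) → c≢y (sym y≡c) ; (c≢y , y∉) (there y∈) → y∉ y∈ }) (c≢ , L∉)

  -- Filtering is monotone for sublists and leaves `L` unchanged, since all its points are
  -- compatible with `c`.
  compatible-⊆ : ∀ {B S D c L cs} → Tabulates B S D → All M B → M c → c ∉ B →
                 All M L → All (c ≢_) L → L ⊆ cs → L ⊆ filter (T? ∘ compatible S D c) cs
  compatible-⊆ {S = S} {D} {c} {L} tab MB Mc c∉ ML c≢ sub = subst (_⊆ _)
    (filter-all (T? ∘ compatible S D c)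
      (All.zipWith (λ (My , c≢y) → compatible-complete tab MB Mc My c≢y c∉) (ML , c≢)))
    (filter⁺ (T? ∘ compatible S D c) (T? ∘ compatible S D c) (λ { refl p → p }) sub)

  -- `L` is a sublist of the candidates, in their order, so the two branches of the search match the
  -- two cases of `L ⊆ c ∷ cs`: `c` is skipped or is the first point of `L`.
  noExtension-sound : ∀ k {B S D} cs {L} → T (noExtension k B S D cs) → Tabulates B S D → All M B →
                      L ⊆ cs → Unique L → All M L → All (_∉ B) L → length L < k
  noExtension-sound (suc k) []       t tab MB [] L! ML L∉ = z<s
  noExtension-sound (suc k) {B} {S} {D} (c ∷ cs) t tab MB sub L! ML L∉ with Equivalence.to T-∨ t
  ... | inj₁ few = ℕ.≤-<-trans (length-mono-≤ sub) (s<s (fewer-sound cs k few))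
  ... | inj₂ t′
    with t₁ , t₂ ← Equivalence.to (T-∧ {noExtension k (c ∷ B) (addSums B c S) (addDiffs B c D)
                                         (filter (T? ∘ compatible S D c) cs)}) t′
    with sub | L! | ML | L∉
  ...   | _ ∷ʳ sub′  | L!      | ML      | L∉      = noExtension-sound (suc k) cs t₂ tab MB sub′ L! ML L∉
  ...   | refl ∷ sub′ | c≢ ∷ L! | Mc ∷ ML | c∉ ∷ L∉ = s<s
    (noExtension-sound k _ t₁ (tabulates-∷ c tab) (Mc ∷ MB)
      (compatible-⊆ tab MB Mc c∉ ML c≢ sub′) L! ML (∉-∷ c≢ L∉))

  noExtensionFrom-sound : ∀ k bs {B S D} cs {L} → T (noExtensionFrom k bs B S D cs) → Tabulates B S D →
                          All M B → L ⊆ cs → Unique (bs ++ L) → All M (bs ++ L) → All (_∉ B) (bs ++ L) →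
                          length L < k
  noExtensionFrom-sound k []       cs t tab MB sub L! ML L∉ = noExtension-sound k cs t tab MB sub L! ML L∉
  noExtensionFrom-sound k (c ∷ bs) {B} cs t tab MB sub (c≢ ∷ L!) (Mc ∷ ML) (c∉ ∷ L∉)
    with Equivalence.to T-∨ t
  ... | inj₁ bad = ⊥-elim (base-conflict-free B tab MB MB Mc c∉ bad)
  ... | inj₂ t′  = noExtensionFrom-sound k bs _ t′ (tabulates-∷ c tab) (Mc ∷ MB)
    (compatible-⊆ tab MB Mc c∉ (All.++⁻ʳ bs ML) (All.++⁻ʳ bs c≢) sub) L! ML (∉-∷ c≢ L∉)

-- The searches in F₃⁵

open import Data.List.Membership.DecPropositional (_≟ᵖ_ {5}) using (_∈?_; _∉?_)
open import Data.List.Relation.Unary.Unique.DecPropositional (_≟ᵖ_ {5}) using (unique?)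

candidates : List (Point 5) → List (Point 5)
candidates bs = filter (_∉? bs) (points 5)

opaque
  -- Opaque, so that the costly evaluation happens only where it is intended, in `allSearches`.
  search : ℕ → List (Point 5) → Bool
  search k bs = noExtensionFrom k bs [] empty empty (candidates bs)

opaque
  unfolding search

  -- `L` consists of all points of `M` outside `bs`, in the order of the candidates; decidability of
  -- `M` allows it to be filtered out.
  search-sound : ∀ {M : Point 5 → Set} → Sidon M → (∀ u → Dec (M u)) →
                 ∀ k bs → T (search k bs) → Unique bs → All M bs →
                 ∃[ L ] length L < k × (∀ {u} → M u → u ∈ bs ++ L)
  search-sound {M} sidon M? k bs t bs! Mbs = L , bound , covers
    where
    L : List (Point 5)
    L = filter M? (candidates bs)
    candidates! : Unique (candidates bs)
    candidates! = Unique.filter⁺ (_∉? bs) (points-unique 5)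
    M×∉ : ∀ {u} → u ∈ L → M u × u ∉ bs
    M×∉ u∈ = let u∈c , Mu = ∈-filter⁻ M? u∈ in Mu , proj₂ (∈-filter⁻ (_∉? bs) {xs = points 5} u∈c)
    bound : length L < k
    bound = noExtensionFrom-sound sidon k bs (candidates bs) t tabulates-[] [] (filter-⊆ M? (candidates bs))
      (Unique.++⁺ bs! (Unique.filter⁺ M? candidates!) λ (u∈bs , u∈L) → proj₂ (M×∉ u∈L) u∈bs)
      (All.++⁺ Mbs (All.tabulate λ u∈ → proj₁ (M×∉ u∈)))
      (All.tabulate λ _ ())
    covers : ∀ {u} → M u → u ∈ bs ++ L
    covers {u} Mu with u ∉? bs
    ... | yes u∉ = ∈-++⁺ʳ bs (∈-filter⁺ M? (∈-filter⁺ (_∉? bs) (∈-points u) u∉) Mu)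
    ... | no ¬u∉ = ∈-++⁺ˡ (decidable-stable (_ ∈? bs) ¬u∉)

-- Coordinates refer to the basis e′, e, a, b, c in this order; the entries are 0, a, b, c, a + b +
-- c, e, e + w, e′.
normalBase : Point 3 → List (Point 5)
normalBase w =
  𝟎 ∷ (0₃ ∷ 0₃ ∷ 1₃ ∷ 0₃ ∷ 0₃ ∷ []) ∷ (0₃ ∷ 0₃ ∷ 0₃ ∷ 1₃ ∷ 0₃ ∷ []) ∷ (0₃ ∷ 0₃ ∷ 0₃ ∷ 0₃ ∷ 1₃ ∷ []) ∷
  (0₃ ∷ 0₃ ∷ 1₃ ∷ 1₃ ∷ 1₃ ∷ []) ∷ (0₃ ∷ 1₃ ∷ 𝟎) ∷ (0₃ ∷ 1₃ ∷ w) ∷ (1₃ ∷ 0₃ ∷ 𝟎) ∷ []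

normalBase-unique : ∀ w → w ≢ 𝟎 → Unique (normalBase w)
normalBase-unique = toWitness {a? = ∀? λ w → ¬? (w ≟ᵖ 𝟎) →-dec unique? (normalBase w)} tt

-- For w = 0 the points e and e + w coincide and no search is run.
zeroOrSearch : Point 3 → Bool
zeroOrSearch w = ⌊ w ≟ᵖ 𝟎 ⌋ ∨ search 6 (normalBase w)

opaque
  unfolding search

  allSearches : all zeroOrSearch (points 3) ≡ true
  -- Checking this `refl` runs the search for all 26 nonzero w. If w is a difference of two of 0, a,
  -- b, c, a + b + c, the base already has a conflict.
  allSearches = refl

noSixMore : ∀ w → w ≢ 𝟎 → T (search 6 (normalBase w))
noSixMore w w≢𝟎 = [ (λ w≡𝟎 → ⊥-elim (w≢𝟎 (toWitness w≡𝟎))) , id ]′ (Equivalence.to (T-∨ {⌊ w ≟ᵖ 𝟎 ⌋})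
  (All.lookup (All.all⁺ zeroOrSearch (points 3) (Equivalence.from T-≡ allSearches)) (∈-points w)))

-- Counting cosets

length-cartesianProduct : ∀ {A B : Set} (xs : List A) (ys : List B) →
                          length (cartesianProduct xs ys) ≡ length xs * length ys
length-cartesianProduct []       ys = refl
length-cartesianProduct (x ∷ xs) ys = trans (length-++ (map (x ,_) ys))
  (cong₂ _+_ (length-map (x ,_) ys) (length-cartesianProduct xs ys))

-- The cosets of the span through the points of `zs` are disjoint and have 3ᵏ points each.
incongruent⇒length≤ : ∀ {k n} {vs : Vec (Point n) k} {zs} → Independent vs → Unique zs →
                      (∀ {z z′ w} → z ∈ zs → z′ ∈ zs → z′ ≡ lin w vs ⊕ z → z ≡ z′) →
                      length zs * length (points k) ≤ length (points n)
incongruent⇒length≤ {k} {n} {vs} {zs} ind zs! incongruent = begin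
  length zs * length (points k)     ≡⟨ length-cartesianProduct zs (points k) ⟨
  length translates                 ≡⟨ length-map translate translates ⟨
  length (map translate translates) ≤⟨ Unique⇒length≤
    (Unique-map⁺ injective (Unique.cartesianProduct⁺ zs! (points-unique k))) (λ {z} _ → ∈-points z) ⟩
  length (points n)                 ∎
  where
  open ℕ.≤-Reasoning
  translates : List (Point n × Point k)
  translates = cartesianProduct zs (points k)
  translate : Point n × Point k → Point n
  translate (z , u) = lin u vs ⊕ z
  injective : ∀ {x y} → x ∈ translates → y ∈ translates → translate x ≡ translate y → x ≡ y
  injective {z , u} {z′ , u′} x∈ y∈ eq with incongruent {w = u ⊖ u′}
    (proj₁ (∈-cartesianProduct⁻ zs (points k) x∈)) (proj₁ (∈-cartesianProduct⁻ zs (points k) y∈))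
    (trans (entails (x₀ ⊞ x₁) (x₂ ⊞ x₃) x₃ ((x₀ ⊟ x₂) ⊞ x₁) (lin u vs ∷ z ∷ lin u′ vs ∷ z′ ∷ []) eq)
           (cong (_⊕ z) (sym (lin-⊖ u u′ vs))))
  ... | refl = cong (z ,_) (lin-injective ind
    (entails (x₀ ⊞ x₁) (x₂ ⊞ x₁) x₀ x₂ (lin u vs ∷ z ∷ lin u′ vs ∷ []) eq))

-- Sidon families

-- Indices stand for the points, so equality of points is decided in `Fin`; `0F` marks the point
-- placed at the origin.
module SidonFamily {n N} (q : Fin (suc N) → Point n) (q-zero : q 0F ≡ 𝟎)
  (sidon : ∀ {i j k l} → q i ⊕ q j ≡ q k ⊕ q l → (i ≡ k × j ≡ l) ⊎ (i ≡ l × j ≡ k)) where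

  q-injective : ∀ {i j} → q i ≡ q j → i ≡ j
  q-injective eq = [ proj₁ , proj₁ ]′ (sidon (cong₂ _⊕_ eq eq))

  sidon₀ : ∀ {i k l} → q i ≡ q k ⊕ q l → (i ≡ k × 0F ≡ l) ⊎ (i ≡ l × 0F ≡ k)
  sidon₀ {i} eq = sidon (trans (cong (q i ⊕_) q-zero) (trans (identity (x₀ ⊞ 𝟘) x₀ (q i ∷ [])) eq))

  distinct? : ((i , j) : Fin (suc N) × Fin (suc N)) → Dec (i ≢ j)
  distinct? (i , j) = ¬? (i ≟ j)

  increasing? : ((i , j) : Fin (suc N) × Fin (suc N)) → Dec (zero {N} Fin.< i × i Fin.< j)
  increasing? (i , j) = zero {N} Fin.<? i ×-dec i Fin.<? j

  pairs offDiagonal increasing : List (Fin (suc N) × Fin (suc N))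
  pairs       = cartesianProduct (allFin (suc N)) (allFin (suc N))
  offDiagonal = filter distinct? pairs
  increasing  = filter increasing? pairs

  pairs! : Unique pairs
  pairs! = Unique.cartesianProduct⁺ (Unique.allFin⁺ (suc N)) (Unique.allFin⁺ (suc N))

  ∈-offDiagonal⁻ : ∀ {i j} → (i , j) ∈ offDiagonal → i ≢ j
  ∈-offDiagonal⁻ ∈o = proj₂ (∈-filter⁻ distinct? {xs = pairs} ∈o)

  ∈-increasing⁻ : ∀ {i j} → (i , j) ∈ increasing → zero {N} Fin.< i × i Fin.< j
  ∈-increasing⁻ ∈i = proj₂ (∈-filter⁻ increasing? {xs = pairs} ∈i)

  minus plus : Fin (suc N) × Fin (suc N) → Point n
  minus (i , j) = q i ⊖ q j
  plus  (i , j) = q i ⊕ q j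

  differences sumsOfPairs : List (Point n)
  differences = map minus offDiagonal
  sumsOfPairs = map plus increasing

  differences! : Unique differences
  differences! = Unique-map⁺ {f = minus} {xs = offDiagonal} injective (Unique.filter⁺ distinct? pairs!)
    where
    injective : ∀ {x y} → x ∈ offDiagonal → y ∈ offDiagonal → minus x ≡ minus y → x ≡ y
    injective {i , j} {k , l} x∈ _ eq with sidon (⊖-cross (q i) (q j) (q k) (q l) eq)
    ... | inj₁ (refl , refl) = refl
    ... | inj₂ (i≡j , _)     = ⊥-elim (∈-offDiagonal⁻ x∈ i≡j)

  sumsOfPairs! : Unique sumsOfPairs
  sumsOfPairs! = Unique-map⁺ {f = plus} {xs = increasing} injective (Unique.filter⁺ increasing? pairs!)
    where
    injective : ∀ {x y} → x ∈ increasing → y ∈ increasing → plus x ≡ plus y → x ≡ y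
    injective x∈ y∈ eq with sidon eq
    ... | inj₁ (refl , refl) = refl
    ... | inj₂ (refl , refl) =
      ⊥-elim (Fin.<-asym (proj₂ (∈-increasing⁻ x∈)) (proj₂ (∈-increasing⁻ y∈)))

  -- A span containing the family contains its differences, which are pairwise distinct. Counting
  -- these, not the points, gives a quadratic bound.
  escape : ∀ {k} (vs : Vec (Point n) k) → length (points k) < length differences → ∃[ i ] ¬ Spans vs (q i)
  escape vs lt with Fin.any? (λ i → ¬? (spans? vs (q i)))
  ... | yes found = found
  ... | no  none  = ⊥-elim (ℕ.<⇒≱ lt (spans-length≤ {vs = vs} differences! inSpan))
    where
    inSpan : ∀ {z} → z ∈ differences → Spans vs z
    inSpan z∈ with (i , j) , _ , refl ← ∈-map⁻ minus z∈
      with u , u↦i ← decidable-stable (spans? vs (q i)) (λ ¬s → none (i , ¬s))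
         | w , w↦j ← decidable-stable (spans? vs (q j)) (λ ¬s → none (j , ¬s))
      = u ⊖ w , trans (lin-⊖ u w vs) (cong₂ _⊖_ u↦i w↦j)

  -- A collision q i - q j = q k + q l is the relation sought; degenerate indices would turn it into
  -- a forbidden equality of sums. Pigeonhole yields the relation in doubly negated form, which
  -- suffices for the goal ⊥.
  fiveTermRelation : length (points n) < length (differences ++ sumsOfPairs) →
    (∀ {i j k l} → 0F ≢ j → 0F ≢ k → 0F ≢ l → j ≢ k → j ≢ l → k ≢ l → q i ≢ q j ⊕ (q k ⊕ q l)) → ⊥
  fiveTermRelation lt noRelation = ℕ.<⇒≱ lt
    (Unique⇒length≤ (Unique.++⁺ differences! sumsOfPairs! disjoint) (λ {z} _ → ∈-points z))
    where
    disjoint : ∀ {z} → ¬ (z ∈ differences × z ∈ sumsOfPairs)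
    disjoint (z∈d , z∈s)
      with (i , j) , ij∈ , refl ← ∈-map⁻ minus z∈d
      with (k , l) , kl∈ , eq ← ∈-map⁻ plus z∈s
      = noRelation {i} {j} {k} {l} 0≢j (Fin.<⇒≢ 0<k) 0≢l j≢k j≢l (Fin.<⇒≢ k<l)
          (entails (x₀ ⊟ x₁) (x₂ ⊞ x₃) x₀ (x₁ ⊞ (x₂ ⊞ x₃)) (q i ∷ q j ∷ q k ∷ q l ∷ []) eq)
      where
      0<k : zero {N} Fin.< k
      0<k = proj₁ (∈-increasing⁻ kl∈)
      k<l : k Fin.< l
      k<l = proj₂ (∈-increasing⁻ kl∈)
      0≢l : 0F ≢ l
      0≢l = Fin.<⇒≢ (ℕ.<-trans 0<k k<l)
      0≢j : 0F ≢ j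
      0≢j refl with sidon₀ {i} {k} {l} (trans (identity x₀ (x₀ ⊟ 𝟘) (q i ∷ []))
                                       (trans (cong (q i ⊖_) (sym q-zero)) eq))
      ... | inj₁ (_ , 0≡l) = 0≢l 0≡l
      ... | inj₂ (_ , 0≡k) = Fin.<⇒≢ 0<k 0≡k
      j≢k : j ≢ k
      -- Since -2 = 1, the equation q i - q k = q k + q l becomes q l = q i + q k.
      j≢k refl with sidon₀ {l} {i} {k}
        (entails (x₀ ⊟ x₁) (x₁ ⊞ x₂) x₂ (x₀ ⊞ x₁) (q i ∷ q k ∷ q l ∷ []) eq)
      ... | inj₁ (_ , 0≡k) = Fin.<⇒≢ 0<k 0≡k
      ... | inj₂ (l≡k , _) = Fin.<⇒≢ k<l (sym l≡k)
      j≢l : j ≢ l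
      j≢l refl with sidon₀ {k} {i} {l}
        (entails (x₀ ⊟ x₁) (x₂ ⊞ x₁) x₂ (x₀ ⊞ x₁) (q i ∷ q l ∷ q k ∷ []) eq)
      ... | inj₁ (_ , 0≡l) = 0≢l 0≡l
      ... | inj₂ (k≡l , _) = Fin.<⇒≢ k<l k≡l

-- Fourteen points

-- The points a + b + c, 0, a, b, c in coordinates on a, b, c. The sum comes first, so that `suc`
-- ranges over the four points whose indices are given as distinct.
e : Fin 5 → Point 3
e = lookup ((1₃ ∷ 1₃ ∷ 1₃ ∷ []) ∷ 𝟎 ∷ (1₃ ∷ 0₃ ∷ 0₃ ∷ []) ∷ (0₃ ∷ 1₃ ∷ 0₃ ∷ []) ∷ (0₃ ∷ 0₃ ∷ 1₃ ∷ []) ∷ [])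

abstract
  -- A linear dependence of a, b, c with coefficients u thus becomes a forbidden equality of two
  -- sums, which makes the axes independent.
  sidonRelation : ∀ u → u ≢ 𝟎 → ∃[ a ] ∃[ b ] ∃[ c ] ∃[ d ] a ≢ c × a ≢ d ×
                  e (suc a) ⊕ e (suc b) ≡ (e (suc c) ⊕ e (suc d)) ⊕ u
  sidonRelation = toWitness {a? = ∀? λ u → ¬? (u ≟ᵖ 𝟎) →-dec
    Fin.any? λ a → Fin.any? λ b → Fin.any? λ c → Fin.any? λ d →
      ¬? (a ≟ c) ×-dec ¬? (a ≟ d) ×-dec (_ ≟ᵖ _)} tt

  -- Any point of the family in the span of a, b, c thus enters an equality of two sums and is one
  -- of the five.
  parallelogram : ∀ u → ∃[ a ] ∃[ b ] ∃[ c ] u ⊕ e a ≡ e b ⊕ e c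
  parallelogram = toWitness {a? = ∀? λ u → Fin.any? λ a → Fin.any? λ b → Fin.any? λ c → _ ≟ᵖ _} tt

module FourteenPoints
  (q : Fin 14 → Point 5) (q-zero : q 0F ≡ 𝟎)
  (sidon : ∀ {i j k l} → q i ⊕ q j ≡ q k ⊕ q l → (i ≡ k × j ≡ l) ⊎ (i ≡ l × j ≡ k)) where

  open SidonFamily q q-zero sidon

  module FiveTerm {i j k l} (0≢j : 0F ≢ j) (0≢k : 0F ≢ k) (0≢l : 0F ≢ l) (j≢k : j ≢ k) (j≢l : j ≢ l) (k≢l : k ≢ l)
                  (relation : q i ≡ q j ⊕ (q k ⊕ q l)) where

    axes : Vec (Point 5) 3
    axes = q j ∷ q k ∷ q l ∷ []

    indices : Vec (Fin 14) 5
    indices = i ∷ 0F ∷ j ∷ k ∷ l ∷ []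

    ix : Fin 5 → Fin 14
    ix = lookup indices

    lin-e : ∀ t → lin (e t) axes ≡ q (ix t)
    lin-e 0F = trans (identity (1₃ ⊡ x₀ ⊞ (1₃ ⊡ x₁ ⊞ (1₃ ⊡ x₂ ⊞ 𝟘))) (x₀ ⊞ (x₁ ⊞ x₂)) axes) (sym relation)
    lin-e 1F = trans (lin-𝟎 axes) (sym q-zero)
    lin-e 2F = identity (1₃ ⊡ x₀ ⊞ (0₃ ⊡ x₁ ⊞ (0₃ ⊡ x₂ ⊞ 𝟘))) x₀ axes
    lin-e 3F = identity (0₃ ⊡ x₀ ⊞ (1₃ ⊡ x₁ ⊞ (0₃ ⊡ x₂ ⊞ 𝟘))) x₁ axes
    lin-e 4F = identity (0₃ ⊡ x₀ ⊞ (0₃ ⊡ x₁ ⊞ (1₃ ⊡ x₂ ⊞ 𝟘))) x₂ axes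

    lin-e-⊕ : ∀ s t → lin (e s ⊕ e t) axes ≡ q (ix s) ⊕ q (ix t)
    lin-e-⊕ s t = trans (lin-⊕ (e s) (e t) axes) (cong₂ _⊕_ (lin-e s) (lin-e t))

    ix-injective : ∀ (s t : Fin 4) → ix (suc s) ≡ ix (suc t) → s ≡ t
    ix-injective = lookup-injective
      ((0≢j VecAll.∷ 0≢k VecAll.∷ 0≢l VecAll.∷ VecAll.[]) VecAllPairs.∷
       (j≢k VecAll.∷ j≢l VecAll.∷ VecAll.[]) VecAllPairs.∷
       (k≢l VecAll.∷ VecAll.[]) VecAllPairs.∷
       VecAll.[] VecAllPairs.∷ VecAllPairs.[])

    axes-independent : Independent axes
    axes-independent u u↦𝟎 with u ≟ᵖ 𝟎
    ... | yes u≡𝟎 = u≡𝟎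
    ... | no  u≢𝟎 with a , b , c , d , a≢c , a≢d , eq ← sidonRelation u u≢𝟎
        with sidon {ix (suc a)} {ix (suc b)} {ix (suc c)} {ix (suc d)}
               (trans (sym (lin-e-⊕ (suc a) (suc b))) (trans (cong (λ z → lin z axes) eq)
                 (trans (lin-⊕ (e (suc c) ⊕ e (suc d)) u axes)
                   (trans (cong₂ _⊕_ (lin-e-⊕ (suc c) (suc d)) u↦𝟎) (identity (x₀ ⊞ 𝟘) x₀ (_ ∷ []))))))
    ...   | inj₁ (eq′ , _) = ⊥-elim (a≢c (ix-injective a c eq′))
    ...   | inj₂ (eq′ , _) = ⊥-elim (a≢d (ix-injective a d eq′))

    spanned⇒known : ∀ {m} → Spans axes (q m) → ∃[ t ] m ≡ ix t
    spanned⇒known {m} (u , u↦m) with a , b , c , eq ← parallelogram u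
      with sidon {m} {ix a} {ix b} {ix c}
             (trans (cong₂ _⊕_ (sym u↦m) (sym (lin-e a))) (trans (sym (lin-⊕ u (e a) axes))
               (trans (cong (λ z → lin z axes) eq) (lin-e-⊕ b c))))
    ... | inj₁ (m≡ , _) = b , m≡
    ... | inj₂ (m≡ , _) = c , m≡

    known? : ∀ m → Dec (∃[ t ] m ≡ ix t)
    known? m = Fin.any? λ t → m ≟ ix t

    other? : ∀ m → Dec (¬ (∃[ t ] m ≡ ix t))
    other? m = ¬? (known? m)

    others : List (Fin 14)
    others = filter other? (allFin 14)

    ∈-others⁻ : ∀ {m} → m ∈ others → ¬ Spans axes (q m)
    ∈-others⁻ m∈ = proj₂ (∈-filter⁻ other? {xs = allFin 14} m∈) ∘ spanned⇒known

    9≤others : 9 ≤ length others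
    9≤others = ℕ.+-cancelˡ-≤ 5 9 (length others)
      (Unique⇒length≤ {ys = map ix (allFin 5) ++ others} (Unique.allFin⁺ 14) cover)
      where
      cover : ∀ {m} → m ∈ allFin 14 → m ∈ map ix (allFin 5) ++ others
      cover {m} m∈ with known? m
      ... | yes (t , refl) = ∈-++⁺ˡ (∈-map⁺ ix (∈-allFin t))
      ... | no  ¬known     = ∈-++⁺ʳ (map ix (allFin 5)) (∈-filter⁺ other? m∈ ¬known)

    -- Otherwise the nine outside points and 0, which represents the span itself, would lie in ten
    -- different cosets, giving 270 vectors among 243.
    congruentPair : (∀ {m m′ w} → ¬ Spans axes (q m) → m ≢ m′ → q m′ ≢ lin w axes ⊕ q m) → ⊥
    congruentPair noPair = ℕ.<⇒≱ (ℕ.<-≤-trans (toWitness {a? = 243 ℕ.<? 270} tt) (ℕ.*-monoˡ-≤ 27 10≤))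
      (incongruent⇒length≤ axes-independent (Unique.map⁺ q-injective representatives!)
        (λ {z} {z′} {w} → incongruent {w = w}))
      where
      representatives : List (Fin 14)
      representatives = 0F ∷ others
      10≤ : 10 ≤ length (map q representatives)
      10≤ = subst (10 ≤_) (sym (length-map q representatives)) (s≤s 9≤others)
      0∉others : 0F ∉ others
      0∉others 0∈ = ∈-others⁻ 0∈ (𝟎 , lin-e 1F)
      representatives! : Unique representatives
      representatives! = All.tabulate (λ { m∈ refl → 0∉others m∈ }) ∷ Unique.filter⁺ other? (Unique.allFin⁺ 14)
      incongruent : ∀ {z z′ w} → z ∈ map q representatives → z′ ∈ map q representatives →
                    z′ ≡ lin w axes ⊕ z → z ≡ z′
      incongruent {w = w} z∈ z′∈ eq with ∈-map⁻ q z∈ | ∈-map⁻ q z′∈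
      ... | m , m∈ , refl | m′ , m′∈ , refl with m ≟ m′
      ...   | yes refl = refl
      ...   | no m≢m′ with m∈ | m′∈
      ...     | there m∈    | _           = ⊥-elim (noPair {w = w} (∈-others⁻ m∈) m≢m′ eq)
      ...     | here refl   | here refl   = ⊥-elim (m≢m′ refl)
      -- The two points are exchanged, with -w for w, so that the one outside the span comes first.
      ...     | here refl   | there m′∈   = ⊥-elim (noPair {w = 𝟎 ⊖ w} (∈-others⁻ m′∈) (m≢m′ ∘ sym)
        (trans (entails x₀ (x₁ ⊞ x₂) x₂ ((𝟘 ⊟ x₁) ⊞ x₀) (q m′ ∷ lin w axes ∷ q 0F ∷ []) eq)
               (cong (_⊕ q m′) (trans (cong (_⊖ lin w axes) (sym (lin-𝟎 axes))) (sym (lin-⊖ 𝟎 w axes))))))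

    module CongruentPair {m m′ w p} (m∉ : ¬ Spans axes (q m)) (m≢m′ : m ≢ m′)
                         (congruent : q m′ ≡ lin w axes ⊕ q m) (p∉ : ¬ Spans (q m ∷ axes) (q p)) where

      frame : Vec (Point 5) 5
      frame = q p ∷ q m ∷ axes

      frame-independent : Independent frame
      frame-independent =
        independent-∷ (independent-∷ axes-independent m∉) p∉

      -- The fourteen points in frame coordinates, where eight of them form `normalBase w`.
      M : Point 5 → Set
      M u = ∃[ t ] lin u frame ≡ q t

      M? : ∀ u → Dec (M u)
      M? u = Fin.any? λ t → lin u frame ≟ᵖ q t

      same : ∀ {u v z} → lin u frame ≡ z → lin v frame ≡ z → u ≡ v
      same u↦ v↦ = lin-injective frame-independent (trans u↦ (sym v↦))

      M-sidon : Sidon M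
      M-sidon {a} {b} {c} {d} (s , a↦) (t , b↦) (s′ , c↦) (t′ , d↦) eq
        with sidon {s} {t} {s′} {t′} (trans (cong₂ _⊕_ (sym a↦) (sym b↦)) (trans (sym (lin-⊕ a b frame))
               (trans (cong (λ z → lin z frame) eq) (trans (lin-⊕ c d frame) (cong₂ _⊕_ c↦ d↦)))))
      ... | inj₁ (refl , refl) = inj₁ (same a↦ c↦ , same b↦ d↦)
      ... | inj₂ (refl , refl) = inj₂ (same a↦ d↦ , same b↦ c↦)

      w≢𝟎 : w ≢ 𝟎
      w≢𝟎 refl = m≢m′ (q-injective (sym (trans congruent
        (trans (cong (_⊕ q m) (lin-𝟎 axes)) (identity (𝟘 ⊞ x₀) x₀ (q m ∷ []))))))

      known-M : ∀ t → M (0₃ ∷ 0₃ ∷ e t)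
      known-M t = ix t , trans
        (identity (0₃ ⊡ x₀ ⊞ (0₃ ⊡ x₁ ⊞ x₂)) x₂ (q p ∷ q m ∷ lin (e t) axes ∷ [])) (lin-e t)

      base-M : All M (normalBase w)
      base-M =
        known-M 1F ∷ known-M 2F ∷ known-M 3F ∷ known-M 4F ∷ known-M 0F ∷
        (m , trans (cong (λ z → 0₃ · q p ⊕ (1₃ · q m ⊕ z)) (lin-𝟎 axes))
                   (identity (0₃ ⊡ x₀ ⊞ (1₃ ⊡ x₁ ⊞ 𝟘)) x₁ (q p ∷ q m ∷ []))) ∷
        (m′ , trans (identity (0₃ ⊡ x₀ ⊞ (1₃ ⊡ x₁ ⊞ x₂)) (x₂ ⊞ x₁) (q p ∷ q m ∷ lin w axes ∷ [])) (sym congruent)) ∷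
        (p , trans (cong (λ z → 1₃ · q p ⊕ (0₃ · q m ⊕ z)) (lin-𝟎 axes))
                   (identity (1₃ ⊡ x₀ ⊞ (0₃ ⊡ x₁ ⊞ 𝟘)) x₀ (q p ∷ q m ∷ []))) ∷
        []

      image : List (Point 5) → List (Point 5)
      image = map (λ u → lin u frame)

      inImage : ∀ {L} → (∀ {u} → M u → u ∈ L) → ∀ {z} → z ∈ map q (allFin 14) → z ∈ image L
      inImage {L} covers z∈ =
        let t , _ , z≡ = ∈-map⁻ q z∈
            u , u↦ = independent⇒spans frame-independent (toWitness {a? = 243 ℕ.<? 729} tt) (q t)
        in subst (_∈ image L) (trans u↦ (sym z≡)) (∈-map⁺ (λ u → lin u frame) (covers {u} (t , u↦)))

      tooMany : ∀ L → length L < 6 → (∀ {u} → M u → u ∈ normalBase w ++ L) → ⊥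
      -- The normal base has 8 points, and 8 + 6 = 14.
      tooMany L L<6 covers = ℕ.<⇒≱ (ℕ.+-monoʳ-< 8 L<6)
        (subst (14 ≤_) (length-map (λ u → lin u frame) (normalBase w ++ L))
          (Unique⇒length≤ (Unique.map⁺ q-injective (Unique.allFin⁺ 14)) (inImage covers)))

      contradictory : ⊥
      contradictory =
        let L , L<6 , covers = search-sound M-sidon M? 6 (normalBase w)
                                 (noSixMore w w≢𝟎) (normalBase-unique w w≢𝟎) base-M
        in tooMany L L<6 covers

  impossible : ⊥
  -- 260 = 182 + 78 differences and sums.
  impossible = fiveTermRelation (toWitness {a? = 243 ℕ.<? 260} tt) λ 0≢j 0≢k 0≢l j≢k j≢l k≢l relation →
    let open FiveTerm 0≢j 0≢k 0≢l j≢k j≢l k≢l relation in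
    congruentPair λ {m} {m′} {w} m∉ m≢m′ congruent →
      -- A span of four vectors has at most 81 elements, against 182 differences.
      let _ , p∉ = escape (q m ∷ axes) (toWitness {a? = 81 ℕ.<? 182} tt) in
      CongruentPair.contradictory {w = w} m∉ m≢m′ congruent p∉

-- 2-caps are Sidon sets

distinct⇒independent : ∀ {n k} {C : List (Point n)} → Is2Cap n C → k ≤ 4 → (ps : Vec (Point n) k) →
                       VecUnique ps → (∀ i → lookup ps i ∈ C) → AffinelyIndependent (lookup ps)
distinct⇒independent (_ , independent) k≤4 ps ps! ps⊆C =
  independent _ k≤4 (lookup ps) (λ {i} {j} → lookup-injective ps! i j) ps⊆C

lookup-≡𝟎 : ∀ {m n} (e : Expr m) (ρ : Vec (Point n) m) → ⟦ e ⟧ ρ ≡ 𝟎 → ∀ j → ⟦ e ⟧₃ (column ρ j) ≡ 0₃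
lookup-≡𝟎 e ρ eq j = trans (sym (lookup-⟦⟧ e ρ j)) (trans (cong (λ v → lookup v j) eq) (lookup-replicate j 0₃))

-- Over F₃ the equation a + a = b + c reads a + b + c = 0, and the coefficients 1, 1, 1 sum to 0: an
-- affine dependence.
2cap⇒noMidpoint : ∀ {n C} → Is2Cap n C → ∀ {a b c} → a ∈ C → b ∈ C → c ∈ C → a ≢ b → a ≢ c → b ≢ c →
                  a ⊕ a ≢ b ⊕ c
2cap⇒noMidpoint {C = C} cap {a} {b} {c} a∈ b∈ c∈ a≢b a≢c b≢c eq with
  distinct⇒independent cap (toWitness {a? = 3 ℕ.≤? 4} tt) points₃
    ((a≢b VecAll.∷ a≢c VecAll.∷ VecAll.[]) VecAllPairs.∷ (b≢c VecAll.∷ VecAll.[]) VecAllPairs.∷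
      VecAll.[] VecAllPairs.∷ VecAllPairs.[])
    (λ { 0F → a∈ ; 1F → b∈ ; 2F → c∈ })
    (lookup (1₃ ∷ 1₃ ∷ 1₃ ∷ [])) refl
    (lookup-≡𝟎 combination points₃ (entails (x₀ ⊞ x₀) (x₁ ⊞ x₂) combination 𝟘 points₃ eq))
    0F
  where
  points₃ = a ∷ b ∷ c ∷ []
  combination = 1₃ ⊡ x₀ ⊞ (1₃ ⊡ x₁ ⊞ (1₃ ⊡ x₂ ⊞ 𝟘))
... | ()

-- The affine dependence has coefficients 1, 1, -1, -1.
2cap⇒noParallelogram : ∀ {n C} → Is2Cap n C → ∀ {a b c d} → a ∈ C → b ∈ C → c ∈ C → d ∈ C →
                       a ≢ b → a ≢ c → a ≢ d → b ≢ c → b ≢ d → c ≢ d → a ⊕ b ≢ c ⊕ d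
2cap⇒noParallelogram cap {a} {b} {c} {d} a∈ b∈ c∈ d∈ a≢b a≢c a≢d b≢c b≢d c≢d eq with
  distinct⇒independent cap ℕ.≤-refl points₄
    ((a≢b VecAll.∷ a≢c VecAll.∷ a≢d VecAll.∷ VecAll.[]) VecAllPairs.∷
      (b≢c VecAll.∷ b≢d VecAll.∷ VecAll.[]) VecAllPairs.∷
      (c≢d VecAll.∷ VecAll.[]) VecAllPairs.∷ VecAll.[] VecAllPairs.∷ VecAllPairs.[])
    (λ { 0F → a∈ ; 1F → b∈ ; 2F → c∈ ; 3F → d∈ })
    (lookup (1₃ ∷ 1₃ ∷ 2₃ ∷ 2₃ ∷ [])) refl
    (lookup-≡𝟎 combination points₄ (entails (x₀ ⊞ x₁) (x₂ ⊞ x₃) combination 𝟘 points₄ eq))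
    0F
  where
  points₄ = a ∷ b ∷ c ∷ d ∷ []
  combination = 1₃ ⊡ x₀ ⊞ (1₃ ⊡ x₁ ⊞ (2₃ ⊡ x₂ ⊞ (2₃ ⊡ x₃ ⊞ 𝟘)))
... | ()

-- If one summand occurs on both sides, cancellation matches the others. If none does, the cases a =
-- b and c = d lead to a = c, to a midpoint or to four distinct points.
2cap⇒sidon : ∀ {n C} → Is2Cap n C → Sidon (_∈ C)
2cap⇒sidon cap {a} {b} {c} {d} a∈ b∈ c∈ d∈ eq with a ≟ᵖ c | a ≟ᵖ d | b ≟ᵖ c | b ≟ᵖ d
... | yes a≡c | _ | _ | _ =
  inj₁ (a≡c , ⊕-cancelˡ c b d (trans (cong (_⊕ b) (sym a≡c)) eq))
... | _ | yes a≡d | _ | _ =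
  inj₂ (a≡d , ⊕-cancelˡ d b c (trans (cong (_⊕ b) (sym a≡d)) (trans eq (⊕-comm c d))))
... | _ | _ | yes b≡c | _ =
  inj₂ (⊕-cancelˡ c a d (trans (⊕-comm c a) (trans (cong (a ⊕_) (sym b≡c)) eq)) , b≡c)
... | _ | _ | _ | yes b≡d =
  inj₁ (⊕-cancelˡ d a c (trans (⊕-comm d a) (trans (cong (a ⊕_) (sym b≡d)) (trans eq (⊕-comm c d)))) , b≡d)
... | no a≢c | no a≢d | no b≢c | no b≢d with a ≟ᵖ b | c ≟ᵖ d
...   | yes refl | yes refl = ⊥-elim (a≢c (entails (x₀ ⊞ x₀) (x₁ ⊞ x₁) x₀ x₁ (a ∷ c ∷ []) eq))
...   | yes refl | no c≢d   = ⊥-elim (2cap⇒noMidpoint cap a∈ c∈ d∈ a≢c a≢d c≢d eq)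
...   | no a≢b   | yes refl = ⊥-elim (2cap⇒noMidpoint cap c∈ a∈ b∈ (a≢c ∘ sym) (b≢c ∘ sym) a≢b (sym eq))
...   | no a≢b   | no c≢d   = ⊥-elim (2cap⇒noParallelogram cap a∈ b∈ c∈ d∈ a≢b a≢c a≢d b≢c b≢d c≢d eq)

-- Sidon sets are 2-caps

∑-cong : ∀ k {f g : Fin k → F₃} → (∀ i → f i ≡ g i) → ∑ k f ≡ ∑ k g
∑-cong zero    f≗g = refl
∑-cong (suc k) f≗g = cong₂ _+₃_ (f≗g zero) (∑-cong k (f≗g ∘ suc))

weightedSum : ∀ {k} → Point k → Point k → F₃
weightedSum {k} c x = ∑ k (λ i → lookup c i *₃ lookup x i)

-- `x` holds one coordinate of all the points, so the implication applies coordinatewise; i ≢ l and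
-- i ≢ m make the resulting equality of sums nontrivial.
HasSidonRelation : ∀ {k} → Point k → Set
HasSidonRelation {k} c = ∃[ i ] ∃[ j ] ∃[ l ] ∃[ m ] i ≢ l × i ≢ m ×
  (∀ (x : Point k) → weightedSum c x ≡ 0₃ → lookup x i +₃ lookup x j ≡ lookup x l +₃ lookup x m)

-- Up to sign, a nontrivial affine relation on at most four points is a = b, 2a = b + c or a + b = c + d.
sidonRelations : ∀ k → k ≤ 4 → (c : Point k) → ∑ k (lookup c) ≡ 0₃ → c ≢ 𝟎 → HasSidonRelation c
sidonRelations k k≤4 = at k k≤4
  where
  hasSidonRelation? : ∀ {k} (c : Point k) → Dec (HasSidonRelation c)
  hasSidonRelation? c = Fin.any? λ i → Fin.any? λ j → Fin.any? λ l → Fin.any? λ m →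
    ¬? (i ≟ l) ×-dec ¬? (i ≟ m) ×-dec ∀? λ x → (weightedSum c x ≟ 0₃) →-dec (_ ≟ _)
  relations? : ∀ k → Dec ((c : Point k) → ∑ k (lookup c) ≡ 0₃ → c ≢ 𝟎 → HasSidonRelation c)
  relations? k = ∀? λ c → (∑ k (lookup c) ≟ 0₃) →-dec (¬? (c ≟ᵖ 𝟎) →-dec hasSidonRelation? c)
  at : ∀ k → k ≤ 4 → (c : Point k) → ∑ k (lookup c) ≡ 0₃ → c ≢ 𝟎 → HasSidonRelation c
  at 0 _ = toWitness {a? = relations? 0} tt
  at 1 _ = toWitness {a? = relations? 1} tt
  at 2 _ = toWitness {a? = relations? 2} tt
  at 3 _ = toWitness {a? = relations? 3} tt
  at 4 _ = toWitness {a? = relations? 4} tt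
  at (suc (suc (suc (suc (suc _))))) (s≤s (s≤s (s≤s (s≤s ()))))

-- `sidonRelations` turns a nonzero affine dependence, coordinate by coordinate, into an equality of
-- sums that violates the Sidon property.
sidon⇒2cap : ∀ {n C} → Unique C → Sidon (_∈ C) → Is2Cap n C
sidon⇒2cap {n} {C} C! sidon = C! , independent
  where
  independent : ∀ k → k ≤ 4 → (p : Fin k → Point n) → Injective _≡_ _≡_ p → (∀ i → p i ∈ C) → AffinelyIndependent p
  independent k k≤4 p p-inj p∈ c ∑c≡0 ∑cp≡0 i with tabulate c ≟ᵖ 𝟎
  ... | yes c≡𝟎 = trans (sym (lookup∘tabulate c i)) (trans (cong (λ v → lookup v i) c≡𝟎) (lookup-replicate i 0₃))
  ... | no  c≢𝟎 = ⊥-elim (absurd (sidonRelations k k≤4 (tabulate c) (trans (∑-cong k (lookup∘tabulate c)) ∑c≡0) c≢𝟎))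
    where
    absurd : ¬ HasSidonRelation (tabulate c)
    absurd (i , j , l , m , i≢l , i≢m , relation) =
      [ i≢l ∘ p-inj ∘ proj₁ , i≢m ∘ p-inj ∘ proj₁ ]′ (sidon (p∈ i) (p∈ j) (p∈ l) (p∈ m) (lookup-ext equation))
      where
      slice : Fin n → Point k
      slice t = tabulate (λ s → lookup (p s) t)
      slice-⊕ : ∀ t i j → lookup (p i ⊕ p j) t ≡ lookup (slice t) i +₃ lookup (slice t) j
      slice-⊕ t i j = trans (lookup-zipWith _+₃_ t (p i) (p j))
        (sym (cong₂ _+₃_ (lookup∘tabulate _ i) (lookup∘tabulate _ j)))
      equation : ∀ t → lookup (p i ⊕ p j) t ≡ lookup (p l ⊕ p m) t
      equation t = trans (slice-⊕ t i j) (trans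
        (relation (slice t) (trans
          (∑-cong k (λ s → cong₂ _*₃_ (lookup∘tabulate c s) (lookup∘tabulate _ s))) (∑cp≡0 t)))
        (sym (slice-⊕ t l m)))

-- A 2-cap with 13 points

cap₁₃ : List (Point 5)
cap₁₃ =
  (0₃ ∷ 0₃ ∷ 0₃ ∷ 0₃ ∷ 0₃ ∷ []) ∷ (1₃ ∷ 0₃ ∷ 0₃ ∷ 0₃ ∷ 0₃ ∷ []) ∷
  (0₃ ∷ 1₃ ∷ 0₃ ∷ 0₃ ∷ 0₃ ∷ []) ∷ (0₃ ∷ 0₃ ∷ 1₃ ∷ 0₃ ∷ 0₃ ∷ []) ∷
  (1₃ ∷ 1₃ ∷ 1₃ ∷ 0₃ ∷ 0₃ ∷ []) ∷ (0₃ ∷ 0₃ ∷ 0₃ ∷ 1₃ ∷ 0₃ ∷ []) ∷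
  (0₃ ∷ 0₃ ∷ 0₃ ∷ 0₃ ∷ 1₃ ∷ []) ∷ (0₃ ∷ 1₃ ∷ 2₃ ∷ 2₃ ∷ 0₃ ∷ []) ∷
  (1₃ ∷ 1₃ ∷ 0₃ ∷ 2₃ ∷ 1₃ ∷ []) ∷ (2₃ ∷ 0₃ ∷ 1₃ ∷ 2₃ ∷ 2₃ ∷ []) ∷
  (2₃ ∷ 0₃ ∷ 1₃ ∷ 1₃ ∷ 1₃ ∷ []) ∷ (0₃ ∷ 2₃ ∷ 1₃ ∷ 0₃ ∷ 2₃ ∷ []) ∷
  (1₃ ∷ 2₃ ∷ 2₃ ∷ 1₃ ∷ 2₃ ∷ []) ∷
  []

abstract
  cap₁₃-unique : Unique cap₁₃
  cap₁₃-unique = toWitness {a? = unique? cap₁₃} tt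

  cap₁₃-sidon : Sidon (_∈ cap₁₃)
  cap₁₃-sidon a∈ b∈ c∈ d∈ = All.lookup (All.lookup (All.lookup (All.lookup table a∈) b∈) c∈) d∈
    where
    table : All (λ a → All (λ b → All (λ c → All (λ d →
              a ⊕ b ≡ c ⊕ d → (a ≡ c × b ≡ d) ⊎ (a ≡ d × b ≡ c)) cap₁₃) cap₁₃) cap₁₃) cap₁₃
    table = toWitness {a? =
      All.all? (λ a → All.all? (λ b → All.all? (λ c → All.all? (λ d →
        (a ⊕ b ≟ᵖ c ⊕ d) →-dec ((a ≟ᵖ c ×-dec b ≟ᵖ d) ⊎-dec (a ≟ᵖ d ×-dec b ≟ᵖ c)))
        cap₁₃) cap₁₃) cap₁₃) cap₁₃} tt

-- The upper bound and the theorem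

2cap⇒length≤13 : (C : List (Point 5)) → Is2Cap 5 C → length C ≤ 13
2cap⇒length≤13 C cap = ℕ.≮⇒≥ λ 14≤ →
  let p : Fin 14 → Point 5
      p i = List.lookup C (inject≤ i 14≤)
      p-injective : ∀ {i j} → p i ≡ p j → i ≡ j
      p-injective eq = inject≤-injective 14≤ 14≤ _ _ (Unique-lookup-injective (proj₁ cap) _ _ eq)
  -- Translation by `p 0F` moves one point to the origin and preserves equalities between sums of
  -- two points.
  in FourteenPoints.impossible (λ i → p i ⊖ p 0F)
       (identity (x₀ ⊟ x₀) 𝟘 (p 0F ∷ []))
       (λ {i} {j} {k} {l} eq → Sum.map (Product.map p-injective p-injective) (Product.map p-injective p-injective)
         (2cap⇒sidon cap (∈-lookup _) (∈-lookup _) (∈-lookup _) (∈-lookup _)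
           (entails ((x₀ ⊟ x₄) ⊞ (x₁ ⊟ x₄)) ((x₂ ⊟ x₄) ⊞ (x₃ ⊟ x₄)) (x₀ ⊞ x₁) (x₂ ⊞ x₃)
                    (p i ∷ p j ∷ p k ∷ p l ∷ p 0F ∷ []) eq)))

theorem3p10 : MaxCapSize 5 13
theorem3p10 = (cap₁₃ , sidon⇒2cap cap₁₃-unique cap₁₃-sidon , refl) , 2cap⇒length≤13
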